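{- Let $P$ be a decreasing tableau, $(r_1,c_1)$ a removable cell of $P$, $\alpha\in\{0,1\}$, and let $\Psi(P,(r_1,c_1),\alpha)=(P',m)$. Let $(r_2,c_2)$ be a removable cell of $P'$, $\alpha'\in\{0,1\}$, and $\Psi(P',(r_2,c_2),\alpha')=(P'',m')$. Then $c_2<c_1$ if and only if $m'>m$.
   Context: Tableaux use English notation; cell $(i,j)$ is in row $i$, column $j$. A decreasing tableau is a filling of the diagram of a partition by positive integers strictly decreasing from left to right along rows and from top to bottom along columns. A cell is removable if it is the last cell of its row and the bottom cell of its column. $P_{>r}$ denotes the tableau obtained by deleting the first $r$ rows of $P$ (rows renumbered from 1), $P_{\ge r}=P_{>r-1}$. A value $x$ is $P$-ejectable if $x$ occurs in the first row of $P$ and either $x-1$ does not occur in the first row, or $x-1$ occurs in the first row and $x-1$ is $P_{>1}$-ejectable (nothing is ejectable in the empty tableau). Bumping path of a removable cell $(r,c)$ of $P$: $m_r$ is the entry of $P$ at $(r,c)$, and for $i=r-1,\dots,1$, $m_i$ is the smallest entry of row $i$ of $P$ with $m_i>m_{i+1}$ (taken with its position). Reverse insertion $\Psi(P,(r,c),\alpha)=(P',m)$: compute the bumping path $m_r<\dots<m_1$ of $(r,c)$ in $P$; set $m:=m_1$ and working tableau $P':=P$. If $\alpha=1$, delete the cell $(r,c)$ (with $m_r$) from $P'$, set $\alpha_r=1$, and process rows $i=r-1,\dots,1$. If $\alpha=0$, set $m_{r+1}=0$, $\alpha_{r+1}=0$, and process rows $i=r,\dots,1$. Processing row $i$, with $R$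 the set of entries of row $i$ of $P$: (D) if $m_i-1\in R$, leave row $i$ unchanged and set $\alpha_i=\alpha_{i+1}$; (DR) otherwise, if $\alpha_{i+1}=1$ and $m_{i+1}\notin R$, replace $m_i$ in row $i$ of $P'$ by $m_{i+1}$ and set $\alpha_i=1$; otherwise let $x$ be the smallest $P'_{>i}$-ejectable value (for the current $P'$) with $m_{i+1}<x<m_i$: (IR) if $x$ exists, replace $m_i$ in row $i$ of $P'$ by $x$ and set $\alpha_i=1$; (NR) if not, leave row $i$ unchanged and set $\alpha_i=0$. The output is the final $P'$ and $m$. -}

module Defs where

open import Data.Nat using (ℕ; zero; suc; _∸_; _<_; _≤_; _≡ᵇ_; _<ᵇ_)
open import Data.Bool using (Bool; true; false; if_then_else_; _∧_; _∨_; not)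
open import Data.List using (List; []; _∷_; length; map; filter; upTo; drop)
open import Data.Bool.ListAction using (any)
open import Data.List.Relation.Unary.All using (All)
open import Data.List.Relation.Unary.Linked using (Linked)
open import Data.Maybe using (Maybe; just; nothing; _>>=_)
open import Data.Product using (_×_; _,_; ∃)
open import Relation.Binary.PropositionalEquality using (_≡_; _≢_)
open import Relation.Nullary using (¬_)
open import Relation.Nullary.Decidable using (does)
open import Data.Nat using (_<?_)

-- Tableaux: list of rows (row 1 first), each row a list of entries
-- read left to right.  Cells are 1-indexed (row i, column j).

Row : Set
Row = List ℕ

Tableau : Set
Tableau = List Row

nth : {A : Set} → List A → ℕ → Maybe A
nth []       _       = nothing
nth (x ∷ xs) zero    = just x
nth (x ∷ xs) (suc n) = nth xs n

rowAt : Tableau → ℕ → Row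
rowAt P zero          = []
rowAt [] (suc i)      = []
rowAt (r ∷ P) (suc zero)    = r
rowAt (r ∷ P) (suc (suc i)) = rowAt P (suc i)

entry : Tableau → ℕ → ℕ → Maybe ℕ
entry P i zero    = nothing
entry P i (suc j) = nth (rowAt P i) j

ColStrict : Row → Row → Set
ColStrict upper lower =
  ∀ j y → nth lower j ≡ just y → ∃ λ x → nth upper j ≡ just x × y < x

record DecreasingTableau (P : Tableau) : Set where
  field
    rowsNonempty : All (λ r → r ≢ []) P
    shape        : Linked (λ r s → length s ≤ length r) P
    positive     : All (All (λ x → 0 < x)) P
    rowsDecr     : All (Linked (λ x y → y < x)) P
    colsDecr     : Linked ColStrict P

Removable : Tableau → ℕ → ℕ → Set
Removable P r c =
  1 ≤ r × 1 ≤ c × length (rowAt P r) ≡ c × length (rowAt P (suc r)) < c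

_∈ᵇ_ : ℕ → Row → Bool
x ∈ᵇ R = any (λ y → y ≡ᵇ x) R

ejectable : Tableau → ℕ → Bool
ejectable []      x = false
ejectable (R ∷ T) x = (x ∈ᵇ R) ∧ (not ((x ∸ 1) ∈ᵇ R) ∨ ejectable T (x ∸ 1))

minimum : List ℕ → Maybe ℕ
minimum []       = nothing
minimum (x ∷ xs) with minimum xs
... | nothing = just x
... | just y  = just (if x <ᵇ y then x else y)

minAbove : Row → ℕ → Maybe ℕ
minAbove R m = minimum (filter (λ y → m <? y) R)

firstBetween : ℕ → ℕ → (ℕ → Bool) → Maybe ℕ
firstBetween lo hi p = go (map (λ k → suc (lo Data.Nat.+ k)) (upTo (hi ∸ suc lo)))
  where
  go : List ℕ → Maybe ℕ
  go []       = nothing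
  go (v ∷ vs) = if p v then just v else go vs

modifyRow : ℕ → (Row → Row) → Tableau → Tableau
modifyRow zero          f P       = P
modifyRow (suc i)       f []      = []
modifyRow (suc zero)    f (R ∷ P) = f R ∷ P
modifyRow (suc (suc i)) f (R ∷ P) = R ∷ modifyRow (suc i) f P

replaceIn : ℕ → ℕ → ℕ → Tableau → Tableau
replaceIn i a b = modifyRow i (map (λ y → if y ≡ᵇ a then b else y))

dropLast : Row → Row
dropLast []           = []
dropLast (x ∷ [])     = []
dropLast (x ∷ y ∷ xs) = x ∷ dropLast (y ∷ xs)

deleteLastOfRow : ℕ → Tableau → Tableau
deleteLastOfRow zero          P       = P
deleteLastOfRow (suc i)       []      = []
deleteLastOfRow (suc zero)    (R ∷ P) with dropLast R
... | []     = P
... | R'     = R' ∷ P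
deleteLastOfRow (suc (suc i)) (R ∷ P) = R ∷ deleteLastOfRow (suc i) P

-- Bumping path.  upPath P k m = [m_k , m_{k-1} , … , m_1] where
-- m_{k+1} = m and m_i = smallest entry of row i of P greater than m_{i+1}.

upPath : Tableau → ℕ → ℕ → Maybe (List ℕ)
upPath P zero    m = just []
upPath P (suc i) m =
  minAbove (rowAt P (suc i)) m >>= λ y →
  upPath P i y >>= λ ys →
  just (y ∷ ys)

bumpingPath : Tableau → ℕ → ℕ → Maybe (List ℕ)
bumpingPath P r c =
  entry P r c >>= λ mr →
  upPath P (r ∸ 1) mr >>= λ rest →
  just (mr ∷ rest)

lastOf : ℕ → List ℕ → ℕ
lastOf d []       = d
lastOf d (x ∷ xs) = lastOf x xs

-- Processing rows i, i-1, …, 1.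
-- process P P' i m_{i+1} α_{i+1} [m_i , … , m_1]  returns the final P'.
-- R = row i of the ORIGINAL P; ejectability is for the CURRENT P'_{>i}.
process : Tableau → Tableau → ℕ → ℕ → Bool → List ℕ → Tableau
process P P' i mNext aNext []          = P'
process P P' i mNext aNext (mi ∷ rest) with (mi ∸ 1) ∈ᵇ rowAt P i
... | true  = process P P' (i ∸ 1) mi aNext rest
... | false with aNext ∧ not (mNext ∈ᵇ rowAt P i)
...   | true  = process P (replaceIn i mi mNext P') (i ∸ 1) mi true rest
...   | false with firstBetween mNext mi (ejectable (drop i P'))
...     | just x  = process P (replaceIn i mi x P') (i ∸ 1) mi true rest
...     | nothing = process P P' (i ∸ 1) mi false rest

-- Reverse insertion Ψ(P,(r,c),α) = (P', m); α = true encodes α = 1.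
-- Returns nothing only if the bumping path is undefined (never for a
-- removable cell of a decreasing tableau).
Ψ : Tableau → ℕ → ℕ → Bool → Maybe (Tableau × ℕ)
Ψ P r c α with bumpingPath P r c
... | nothing = nothing
... | just [] = nothing
... | just (mr ∷ rest) with α
...   | true  = just (process P (deleteLastOfRow r P) (r ∸ 1) mr true rest ,
                      lastOf mr rest)
...   | false = just (process P P r 0 false (mr ∷ rest) , lastOf mr rest)

{-# OPTIONS --safe #-}
module Submission where

-- Compare the two bumping paths m_i (in P) and m′_i (in P′) row by row, going up.
-- If the second starts below the first processed row of P, every m′_i
-- is ejectable in P′_{≥i}: if m′_i − 1 lies in row i, minimality forces it to be
-- m′_{i+1}.  As the value replacing m_i is the least ejectable one above m_{i+1}
-- (or m_{i+1} itself), it is at most m′_{i+1}, so m_{i+1} < m′_{i+1} propagates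
-- to m_i < m′_i.  If the second path starts in or above it, it starts at the
-- least entry of its row, and m′_i ≤ m_i propagates, together with m′_i < m_i
-- when α_i = 1.

open import Defs
open import Data.Nat using (ℕ; zero; suc; _+_; _∸_; _<_; _≤_; _>_; _≡ᵇ_; _<ᵇ_; z≤n; s≤s; _<?_; _≤?_)
open import Data.Nat.Properties
open import Data.Bool using (Bool; true; false; if_then_else_; _∧_; not)
open import Data.Bool.Properties using (∧-conicalˡ; T-≡)
open import Data.List using (List; []; _∷_; length; map; upTo; drop)
open import Data.List.Properties using (length-map)
open import Data.List.Membership.Propositional using (_∈_)
open import Data.List.Membership.Propositional.Properties
  using (∈-map⁺; ∈-map⁻; ∈-upTo⁺; ∈-upTo⁻; ∈-filter⁺; ∈-filter⁻)
open import Data.List.Relation.Unary.All as All using (All; []; _∷_)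
open import Data.List.Relation.Unary.AllPairs using (AllPairs; []; _∷_)
import Data.List.Relation.Unary.AllPairs.Properties as AllPairs
open import Data.List.Relation.Unary.Any as Any using (here; there)
open import Data.List.Relation.Unary.Any.Properties using (any⁺; any⁻)
open import Data.List.Relation.Unary.Linked using (Linked; []; [-]; _∷_)
open import Data.List.Relation.Unary.Linked.Properties using (Linked⇒AllPairs)
open import Data.Maybe using (Maybe; just; nothing)
open import Data.Product using (∃; ∃₂; _×_; _,_; proj₁; proj₂)
open import Data.Sum using (_⊎_; inj₁; inj₂)
open import Function using (_∘_; case_of_)
open import Function.Bundles using (_⇔_; mk⇔; Equivalence)
open import Relation.Binary.PropositionalEquality
open import Relation.Nullary using (yes; no; contradiction)

-- Boolean membership and substitution in a row

∈ᵇ⇒∈ : ∀ {x} R → (x ∈ᵇ R) ≡ true → x ∈ R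
∈ᵇ⇒∈ {x} R eq =
  Any.map (λ {y} → sym ∘ ≡ᵇ⇒≡ y x) (any⁻ (_≡ᵇ x) R (Equivalence.from T-≡ eq))

∈⇒∈ᵇ : ∀ {x R} → x ∈ R → (x ∈ᵇ R) ≡ true
∈⇒∈ᵇ {x} x∈R =
  Equivalence.to T-≡ (any⁺ (_≡ᵇ x) (Any.map (λ {y} → ≡⇒≡ᵇ y x ∘ sym) x∈R))

sub : ℕ → ℕ → ℕ → ℕ
sub a b y = if y ≡ᵇ a then b else y

sub-cases : ∀ a b y → (y ≡ a × sub a b y ≡ b) ⊎ (y ≢ a × sub a b y ≡ y)
sub-cases a b y with y ≡ᵇ a in eq
... | true  = inj₁ (≡ᵇ⇒≡ y a (Equivalence.from T-≡ eq) , refl)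
... | false = inj₂ ((λ y≡a → case trans (sym eq) (Equivalence.to T-≡ (≡⇒≡ᵇ y a y≡a)) of λ ()) , refl)

∈-map-sub⁻ : ∀ {a b z R} → z ∈ map (sub a b) R → z ≡ b ⊎ (z ∈ R × z ≢ a)
∈-map-sub⁻ {a} {b} z∈ with ∈-map⁻ (sub a b) z∈
... | y , y∈R , refl with sub-cases a b y
...   | inj₁ (_ , eq)   = inj₁ eq
...   | inj₂ (y≢a , eq) = inj₂ (subst (_∈ _) (sym eq) y∈R , y≢a ∘ trans (sym eq))

∈-map-sub⁺ : ∀ {a R} b → a ∈ R → b ∈ map (sub a b) R
∈-map-sub⁺ {a} {R} b a∈R with sub-cases a b a
... | inj₁ (_ , eq)   = subst (_∈ map (sub a b) R) eq (∈-map⁺ (sub a b) a∈R)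
... | inj₂ (a≢a , _) = contradiction refl a≢a

-- The search for the least ejectable value between two bounds

interval : ℕ → ℕ → List ℕ
interval lo hi = map (λ k → suc (lo + k)) (upTo (hi ∸ suc lo))

mutual
  -- The placeholder is solved by the local search function of firstBetween,
  -- which cannot be named from outside Defs.
  search : ℕ → ℕ → (ℕ → Bool) → List ℕ → Maybe ℕ
  search = _

  firstBetween≡search : ∀ lo hi p →
    firstBetween lo hi p ≡ search lo hi p (interval lo hi)
  -- With the candidate list abstracted, the unknown function is applied to variables only, so the
  -- equation determines it.
  firstBetween≡search lo hi p with interval lo hi
  ... | vs = refl

search-nothing : ∀ lo hi p vs → search lo hi p vs ≡ nothing → ∀ {k} → k ∈ vs → p k ≡ true → ∀ {A : Set} → A
search-nothing lo hi p (v ∷ vs) eq k∈ pk with p v in pv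
search-nothing lo hi p (v ∷ vs) () k∈ pk | true
search-nothing lo hi p (v ∷ vs) eq (here refl) pk | false = case trans (sym pv) pk of λ ()
search-nothing lo hi p (v ∷ vs) eq (there k∈) pk | false = search-nothing lo hi p vs eq k∈ pk

search-just : ∀ lo hi p vs {x} → AllPairs _<_ vs → search lo hi p vs ≡ just x →
  x ∈ vs × (∀ {k} → k ∈ vs → p k ≡ true → x ≤ k)
search-just lo hi p (v ∷ vs) (v< ∷ vs↑) eq with p v in pv
search-just lo hi p (v ∷ vs) (v< ∷ vs↑) refl | true = here refl , λ
  { (here refl) _ → ≤-refl
  ; (there k∈) _ → <⇒≤ (All.lookup v< k∈) }
search-just lo hi p (v ∷ vs) (v< ∷ vs↑) eq | false with search-just lo hi p vs vs↑ eq
... | x∈ , least = there x∈ , λ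
  { (here refl) pk → case trans (sym pv) pk of λ ()
  ; (there k∈) pk → least k∈ pk }

∈-interval⁺ : ∀ {lo hi k} → lo < k → k < hi → k ∈ interval lo hi
∈-interval⁺ {lo} {hi} {k} lo<k k<hi =
  subst (_∈ interval lo hi) (m+[n∸m]≡n lo<k)
    (∈-map⁺ (λ k → suc (lo + k)) (∈-upTo⁺ (∸-monoˡ-< k<hi lo<k)))

∈-interval⁻ : ∀ {lo hi k} → k ∈ interval lo hi → lo < k × k < hi
∈-interval⁻ {lo} {hi} k∈ with ∈-map⁻ (λ k → suc (lo + k)) k∈
... | d , d∈ , refl =
  s≤s (m≤m+n lo d) , ≰⇒> λ hi≤k →
    <⇒≱ (∈-upTo⁻ d∈) (subst (hi ∸ suc lo ≤_) (m+n∸m≡n lo d) (∸-monoˡ-≤ (suc lo) hi≤k))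

interval-sorted : ∀ lo hi → AllPairs _<_ (interval lo hi)
interval-sorted lo hi =
  AllPairs.map⁺ (AllPairs.applyUpTo⁺₁ _ (hi ∸ suc lo) (λ i<j _ → s≤s (+-monoʳ-< lo i<j)))

firstBetween-nothing : ∀ {lo hi p} → firstBetween lo hi p ≡ nothing →
  ∀ {k} → lo < k → p k ≡ true → hi ≤ k
firstBetween-nothing {lo} {hi} {p} eq {k} lo<k pk with hi ≤? k
... | yes hi≤k = hi≤k
... | no hi≰k  = search-nothing lo hi p _ (trans (sym (firstBetween≡search lo hi p)) eq)
                   (∈-interval⁺ lo<k (≰⇒> hi≰k)) pk

-- The lower bound extends to candidates at or beyond `hi`, since `x < hi`. In this form it applies
-- to a value of the second path without knowing that value to be below `hi`.
firstBetween-just : ∀ {lo hi p x} → firstBetween lo hi p ≡ just x →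
  lo < x × x < hi × (∀ {k} → lo < k → p k ≡ true → x ≤ k)
firstBetween-just {lo} {hi} {p} {x} eq
  with search-just lo hi p _ (interval-sorted lo hi) (trans (sym (firstBetween≡search lo hi p)) eq)
... | x∈ , least with ∈-interval⁻ x∈
...   | lo<x , x<hi = lo<x , x<hi , λ {k} lo<k pk → case k <? hi of λ
  { (yes k<hi) → least (∈-interval⁺ lo<k k<hi) pk
  ; (no k≮hi) → <⇒≤ (<-≤-trans x<hi (≮⇒≥ k≮hi)) }

-- Least entries above a bound

IsMinAbove : Row → ℕ → ℕ → Set
IsMinAbove R l y = y ∈ R × l < y × (∀ {z} → z ∈ R → l < z → y ≤ z)

minimum-just : ∀ xs {y} → minimum xs ≡ just y → y ∈ xs × All (y ≤_) xs
minimum-just (x ∷ xs) eq with minimum xs in eqₘ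
minimum-just (x ∷ [])      refl | nothing = here refl , ≤-refl ∷ []
minimum-just (x ∷ x′ ∷ xs) eq   | nothing with minimum xs
minimum-just (x ∷ x′ ∷ xs) eq   | nothing | nothing = case eqₘ of λ ()
minimum-just (x ∷ x′ ∷ xs) eq   | nothing | just _  = case eqₘ of λ ()
minimum-just (x ∷ xs) eq | just y with minimum-just xs eqₘ | x <ᵇ y in x<ᵇy
minimum-just (x ∷ xs) refl | just y | y∈ , y≤ | true  =
  here refl , ≤-refl ∷ All.map (≤-trans (<⇒≤ (<ᵇ⇒< x y (Equivalence.from T-≡ x<ᵇy)))) y≤
minimum-just (x ∷ xs) refl | just y | y∈ , y≤ | false =
  there y∈ , ≮⇒≥ (λ x<y → case trans (sym x<ᵇy) (Equivalence.to T-≡ (<⇒<ᵇ x<y)) of λ ()) ∷ y≤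

minAbove-just : ∀ R {l y} → minAbove R l ≡ just y → IsMinAbove R l y
minAbove-just R {l} eq with minimum-just _ eq
... | y∈ , y≤ with ∈-filter⁻ (l <?_) {xs = R} y∈
...   | y∈R , l<y = y∈R , l<y , λ z∈R l<z → All.lookup y≤ (∈-filter⁺ (l <?_) z∈R l<z)

-- Decreasing rows and their last entries

nth⇒∈ : ∀ (R : Row) n {k} → nth R n ≡ just k → k ∈ R
nth⇒∈ (x ∷ R) zero    refl = here refl
nth⇒∈ (x ∷ R) (suc n) eq   = there (nth⇒∈ R n eq)

nth-map : ∀ (f : ℕ → ℕ) R n {k} → nth (map f R) n ≡ just k → ∃ λ l → nth R n ≡ just l × f l ≡ k
nth-map f (x ∷ R) zero    refl = x , refl , refl
nth-map f (x ∷ R) (suc n) eq   = nth-map f R n eq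

IsLast : Row → ℕ → Set
IsLast R k = ∃ λ n → length R ≡ suc n × nth R n ≡ just k

Good : Row → Set
Good R = AllPairs _>_ R × All (0 <_) R

last-least : ∀ {R k} → AllPairs _>_ R → IsLast R k → All (k ≤_) R
last-least {x ∷ []}    _           (zero , _ , refl)       = ≤-refl ∷ []
last-least {x ∷ y ∷ R} (x> ∷ R↓) (suc n , len , eq) with last-least R↓ (n , suc-injective len , eq)
... | k≤y ∷ k≤R = <⇒≤ (≤-<-trans k≤y (All.head x>)) ∷ k≤y ∷ k≤R

-- The last entry is the least, and positivity excludes `k = 0`, where truncated subtraction would
-- give `k ∸ 1 = k`. So the entry at which a second path starts is ejectable whatever lies below it.
last-pred∉ : ∀ {R k} → Good R → IsLast R k → k ∸ 1 ∈ R → ∀ {A : Set} → A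
last-pred∉ {R} {k} (R↓ , R⁺) last@(n , _ , eq) k-1∈ with k | All.lookup R⁺ (nth⇒∈ R n eq) | All.lookup (last-least R↓ last) k-1∈
... | suc k′ | _ | 1+k≤k = contradiction 1+k≤k 1+n≰n

dropLast-All : ∀ {Q : ℕ → Set} R → All Q R → All Q (dropLast R)
dropLast-All []          _              = []
dropLast-All (x ∷ [])    _              = []
dropLast-All (x ∷ y ∷ R) (px ∷ pyR) = px ∷ dropLast-All (y ∷ R) pyR

dropLast-Good : ∀ R → Good R → Good (dropLast R)
dropLast-Good R (R↓ , R⁺) = go R R↓ , dropLast-All R R⁺
  where
  go : ∀ R → AllPairs _>_ R → AllPairs _>_ (dropLast R)
  go []          _           = []
  go (x ∷ [])    _           = []
  go (x ∷ y ∷ R) (x> ∷ R↓) = dropLast-All (y ∷ R) x> ∷ go (y ∷ R) R↓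

length-dropLast : ∀ R {n} → length R ≡ suc n → length (dropLast R) ≡ n
length-dropLast (x ∷ [])    refl = refl
length-dropLast (x ∷ y ∷ R) refl = cong suc (length-dropLast (y ∷ R) refl)

last<dropLast : ∀ {R k} → AllPairs _>_ R → IsLast R k → All (k <_) (dropLast R)
last<dropLast {x ∷ []}    _           _                  = []
last<dropLast {x ∷ y ∷ R} (x> ∷ R↓) (suc n , len , eq) =
  ≤-<-trans (All.head (last-least R↓ last)) (All.head x>) ∷ last<dropLast R↓ last
  where last = n , suc-injective len , eq

-- Rows of a tableau under dropping, replacement and deletion

rowAt-All : ∀ {Q : Row → Set} → Q [] → ∀ {P} → All Q P → ∀ i → Q (rowAt P i)
rowAt-All q[] []       zero          = q[]
rowAt-All q[] []       (suc i)       = q[]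
rowAt-All q[] (q ∷ qs) zero          = q[]
rowAt-All q[] (q ∷ qs) (suc zero)    = q
rowAt-All q[] (q ∷ qs) (suc (suc i)) = rowAt-All q[] qs (suc i)

rowAt-drop : ∀ T i k → rowAt (drop i T) (suc k) ≡ rowAt T (suc (i + k))
rowAt-drop T       zero    k = refl
rowAt-drop []      (suc i) k = refl
rowAt-drop (R ∷ T) (suc i) k = rowAt-drop T i k

rowAt-cong-drop : ∀ {T Q i j} → drop i T ≡ drop i Q → i ≤ j → rowAt T (suc j) ≡ rowAt Q (suc j)
rowAt-cong-drop {T} {Q} {i} eq i≤j with m≤n⇒∃[o]m+o≡n i≤j
... | k , refl = trans (sym (rowAt-drop T i k)) (trans (cong (λ X → rowAt X (suc k)) eq) (rowAt-drop Q i k))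

drop-suc : ∀ (T : Tableau) i → drop (suc i) T ≡ drop 1 (drop i T)
drop-suc T       zero    = refl
drop-suc []      (suc i) = refl
drop-suc (R ∷ T) (suc i) = drop-suc T i

drop-suc-cong : ∀ {T Q : Tableau} i → drop i T ≡ drop i Q → drop (suc i) T ≡ drop (suc i) Q
drop-suc-cong {T} {Q} i eq = trans (drop-suc T i) (trans (cong (drop 1) eq) (sym (drop-suc Q i)))

rowAt-length-mono : ∀ {P} → Linked (λ r s → length s ≤ length r) P →
  ∀ {i j} → i ≤ j → length (rowAt P (suc j)) ≤ length (rowAt P (suc i))
rowAt-length-mono {P} sh {i} i≤j with m≤n⇒∃[o]m+o≡n i≤j
... | k , refl = go k
  where
  next : ∀ {P} → Linked (λ r s → length s ≤ length r) P → ∀ i →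
    length (rowAt P (suc (suc i))) ≤ length (rowAt P (suc i))
  next []        i       = z≤n
  next [-]       i       = z≤n
  next (l ∷ sh)  zero    = l
  next (l ∷ sh)  (suc i) = next sh i
  go : ∀ k → length (rowAt P (suc (i + k))) ≤ length (rowAt P (suc i))
  go zero    = ≤-reflexive (cong (λ n → length (rowAt P (suc n))) (+-identityʳ i))
  go (suc k) rewrite +-suc i k = ≤-trans (next sh (i + k)) (go k)

rowAt-modifyRow-≡ : ∀ f → f [] ≡ [] → ∀ Q i →
  rowAt (modifyRow (suc i) f Q) (suc i) ≡ f (rowAt Q (suc i))
rowAt-modifyRow-≡ f f[] []      i       = sym f[]
rowAt-modifyRow-≡ f f[] (R ∷ Q) zero    = refl
rowAt-modifyRow-≡ f f[] (R ∷ Q) (suc i) = rowAt-modifyRow-≡ f f[] Q i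

rowAt-modifyRow-< : ∀ f Q i j → j ≤ i → rowAt (modifyRow (suc i) f Q) j ≡ rowAt Q j
rowAt-modifyRow-< f []      i       j             j≤i       = refl
rowAt-modifyRow-< f (R ∷ Q) zero    zero          j≤i       = refl
rowAt-modifyRow-< f (R ∷ Q) (suc i) zero          j≤i       = refl
rowAt-modifyRow-< f (R ∷ Q) (suc i) (suc zero)    j≤i       = refl
rowAt-modifyRow-< f (R ∷ Q) (suc i) (suc (suc j)) (s≤s j≤i) = rowAt-modifyRow-< f Q i (suc j) j≤i

drop-modifyRow : ∀ f Q i → drop (suc i) (modifyRow (suc i) f Q) ≡ drop (suc i) Q
drop-modifyRow f []      i       = refl
drop-modifyRow f (R ∷ Q) zero    = refl
drop-modifyRow f (R ∷ Q) (suc i) = drop-modifyRow f Q i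

rowAt-deleteLast-< : ∀ Q i j → j ≤ i → rowAt (deleteLastOfRow (suc i) Q) j ≡ rowAt Q j
rowAt-deleteLast-< []      i       j             j≤i       = refl
rowAt-deleteLast-< (R ∷ Q) zero    zero          j≤i       with dropLast R
... | []    = case Q of λ { [] → refl ; (_ ∷ _) → refl }
... | _ ∷ _ = refl
rowAt-deleteLast-< (R ∷ Q) (suc i) zero          j≤i       = refl
rowAt-deleteLast-< (R ∷ Q) (suc i) (suc zero)    j≤i       = refl
rowAt-deleteLast-< (R ∷ Q) (suc i) (suc (suc j)) (s≤s j≤i) = rowAt-deleteLast-< Q i (suc j) j≤i

-- Deleting the only entry of a row removes the row and renumbers the rows below it.
rowAt-deleteLast-≥ : ∀ Q i j → i ≤ j →
  (rowAt (deleteLastOfRow (suc i) Q) (suc j) ≡ dropLast (rowAt Q (suc i))) ⊎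
  (∃ λ k → i < k × rowAt (deleteLastOfRow (suc i) Q) (suc j) ≡ rowAt Q (suc k)
         × (j ≡ i → dropLast (rowAt Q (suc i)) ≡ []))
rowAt-deleteLast-≥ []      i       j       i≤j       = inj₁ refl
rowAt-deleteLast-≥ (R ∷ Q) zero    j       i≤j       with dropLast R
... | [] = inj₂ (suc j , s≤s z≤n , refl , λ _ → refl)
... | _ ∷ _ with j
...   | zero   = inj₁ refl
...   | suc j′ = inj₂ (suc j′ , s≤s z≤n , refl , λ ())
rowAt-deleteLast-≥ (R ∷ Q) (suc i) (suc j) (s≤s i≤j) with rowAt-deleteLast-≥ Q i j i≤j
... | inj₁ eq                  = inj₁ eq
... | inj₂ (k , i<k , eq , eq[]) = inj₂ (suc k , s≤s i<k , eq , eq[] ∘ suc-injective)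

-- Ejectable values and bumping paths

ejectable⁻ : ∀ T i {k} → ejectable (drop i T) k ≡ true → k ∈ rowAt T (suc i)
ejectable⁻ []      zero    ()
ejectable⁻ []      (suc i) ()
ejectable⁻ (R ∷ T) zero    e = ∈ᵇ⇒∈ R (∧-conicalˡ _ _ e)
ejectable⁻ (R ∷ T) (suc i) e = ejectable⁻ T i e

ejectable⁺ : ∀ T i {k} → k ∈ rowAt T (suc i) →
  (k ∸ 1 ∈ rowAt T (suc i) → ejectable (drop (suc i) T) (k ∸ 1) ≡ true) →
  ejectable (drop i T) k ≡ true
ejectable⁺ (R ∷ T) (suc i) k∈ h = ejectable⁺ T i k∈ h
ejectable⁺ (R ∷ T) zero {k} k∈ h with (k ∸ 1) ∈ᵇ R in eq
... | true  rewrite ∈⇒∈ᵇ k∈ = h (∈ᵇ⇒∈ R eq)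
... | false rewrite ∈⇒∈ᵇ k∈ = refl

data Climb (P : Tableau) : ℕ → ℕ → List ℕ → Set where
  []  : ∀ {l} → Climb P zero l []
  _∷_ : ∀ {i l y ys} → IsMinAbove (rowAt P (suc i)) l y → Climb P i y ys →
        Climb P (suc i) l (y ∷ ys)

upPath⇒Climb : ∀ P i l {ys} → upPath P i l ≡ just ys → Climb P i l ys
upPath⇒Climb P zero    l refl = []
upPath⇒Climb P (suc i) l eq with minAbove (rowAt P (suc i)) l in eqₘ
upPath⇒Climb P (suc i) l () | nothing
... | just y with upPath P i y in eqᵤ
upPath⇒Climb P (suc i) l ()   | just y | nothing
upPath⇒Climb P (suc i) l refl | just y | just ys =
  minAbove-just (rowAt P (suc i)) eqₘ ∷ upPath⇒Climb P i y eqᵤ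

-- Otherwise `y ∸ 1` would be an entry above `l` smaller than the least one.
minAbove-pred : ∀ {R l y} → IsMinAbove R l y → y ∸ 1 ∈ R → y ∸ 1 ≤ l
minAbove-pred {l = l} {y = zero}  (_ , () , _) y-1∈
minAbove-pred {l = l} {y = suc y} (_ , _ , least) y-1∈ with y ≤? l
... | yes y≤l = y≤l
... | no y≰l  = contradiction (least y-1∈ (≰⇒> y≰l)) 1+n≰n

-- If `y ∸ 1` lies in the row, minimality gives `y ∸ 1 ≤ l`, while `l < y` gives the converse. So
-- `y ∸ 1` is `l`, whose ejectability is exactly what the recursive clause asks for.
climb-ejectable : ∀ {T i l y} → IsMinAbove (rowAt T (suc i)) l y →
  ejectable (drop (suc i) T) l ≡ true → ejectable (drop i T) y ≡ true
climb-ejectable {T} {i} {l} {y} min@(y∈ , l<y , _) e = ejectable⁺ T i y∈ λ y-1∈ →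
  subst (λ z → ejectable (drop (suc i) T) z ≡ true)
    (≤-antisym (<⇒≤pred l<y) (minAbove-pred min y-1∈)) e

climb-to : ∀ {T j k ks} i → i ≤ j → Climb T j k ks → ejectable (drop j T) k ≡ true →
  ∃₂ λ k′ ks′ → Climb T i k′ ks′ × ejectable (drop i T) k′ ≡ true × lastOf k′ ks′ ≡ lastOf k ks
climb-to {j = j} i i≤j climb e with m≤n⇒m<n∨m≡n i≤j
... | inj₂ refl = _ , _ , climb , e , refl
climb-to {T} i i≤j (min ∷ climb) e | inj₁ (s≤s i≤j′) = climb-to i i≤j′ climb (climb-ejectable {T} min e)

-- The processing of rows as a trace

-- One step of process at a row: R and R′ are the row before and after, E the rows
-- below it, l and m the path values below and in the row.  Of the value
-- that replaces m we keep only that it bounds from below the ejectable values above l.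
data Step (R R′ : Row) (E : Tableau) (l : ℕ) (a : Bool) (m : ℕ) : Bool → Set where
  stay  : m ∸ 1 ∈ R → R′ ≡ R → Step R R′ E l a m a
  shift : a ≡ true → R′ ≡ map (sub m l) R → Step R R′ E l a m true
  eject : ∀ {x} → l < x → x < m → (∀ {k} → l < k → ejectable E k ≡ true → x ≤ k) →
          R′ ≡ map (sub m x) R → Step R R′ E l a m true
  none  : (∀ {k} → l < k → ejectable E k ≡ true → m ≤ k) → R′ ≡ R → Step R R′ E l a m false

-- Here `l` and `a` are the path value and the bit arriving from the row below, and `m` is the path
-- value finally reached. The final tableau `T` can stand for every intermediate one: a row changes
-- only while it is processed, and the rows below it are final when ejectability is tested.
data Trace (P T : Tableau) (m : ℕ) : ℕ → ℕ → Bool → Set where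
  done : ∀ {a} → Trace P T m zero m a
  step : ∀ {i l a y a′} → IsMinAbove (rowAt P (suc i)) l y →
         Step (rowAt P (suc i)) (rowAt T (suc i)) (drop (suc i) T) l a y a′ →
         Trace P T m i y a′ → Trace P T m (suc i) l a

Step-cong : ∀ {R R₁ R₂ E₁ E₂ l a m a′} → R₁ ≡ R₂ → E₁ ≡ E₂ → Step R R₂ E₂ l a m a′ → Step R R₁ E₁ l a m a′
Step-cong refl refl s = s

Processed : Tableau → Tableau → Tableau → ℕ → ℕ → Bool → List ℕ → Set
Processed P Q T i l a ys = Trace P T (lastOf l ys) i l a × drop i T ≡ drop i Q

extend : ∀ {P Q Q′ T i l a y ys a′} → IsMinAbove (rowAt P (suc i)) l y →
  Step (rowAt P (suc i)) (rowAt Q′ (suc i)) (drop (suc i) Q) l a y a′ →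
  drop (suc i) Q′ ≡ drop (suc i) Q →
  Processed P Q′ T i y a′ ys → Processed P Q T (suc i) l a (y ∷ ys)
extend {Q = Q} {Q′} {T} {i} min s Q′≡Q (tr , T≡Q′) =
  step min (Step-cong (rowAt-cong-drop {T} {Q′} {i} T≡Q′ ≤-refl) T≡Q s) tr , T≡Q
  where
  T≡Q : drop (suc i) T ≡ drop (suc i) Q
  T≡Q = trans (drop-suc-cong {T} {Q′} i T≡Q′) Q′≡Q

-- The hypothesis on `Q` says that rows still to be processed are those of `P`, so each replacement
-- acts on an original row. Recursing on the modified tableau preserves this for the rows above.
process-spec : ∀ P Q {i l a ys} → Climb P i l ys →
  (∀ j → j ≤ i → rowAt Q j ≡ rowAt P j) →
  Processed P Q (process P Q i l a ys) i l a ys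
process-spec P Q [] Q≡P = done , refl
process-spec P Q {suc i} {l} {a} {y ∷ ys} (min ∷ climb) Q≡P = go
  where
  row≡ : rowAt Q (suc i) ≡ rowAt P (suc i)
  row≡ = Q≡P (suc i) ≤-refl

  kept : ∀ {a′} → Step (rowAt P (suc i)) (rowAt Q (suc i)) (drop (suc i) Q) l a y a′ →
    Processed P Q (process P Q i y a′ ys) (suc i) l a (y ∷ ys)
  kept s = extend {Q = Q} {Q} {ys = ys} min s refl (process-spec P Q climb (λ j j≤i → Q≡P j (m≤n⇒m≤1+n j≤i)))

  replaced : ∀ x → (rowAt (replaceIn (suc i) y x Q) (suc i) ≡ map (sub y x) (rowAt P (suc i)) →
      Step (rowAt P (suc i)) (rowAt (replaceIn (suc i) y x Q) (suc i)) (drop (suc i) Q) l a y true) →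
    Processed P Q (process P (replaceIn (suc i) y x Q) i y true ys) (suc i) l a (y ∷ ys)
  replaced x s =
    extend {Q = Q} {replaceIn (suc i) y x Q} {ys = ys} min
      (s (trans (rowAt-modifyRow-≡ _ refl Q i) (cong (map (sub y x)) row≡)))
      (drop-modifyRow _ Q i)
      (process-spec P (replaceIn (suc i) y x Q) climb λ j j≤i →
        trans (rowAt-modifyRow-< _ Q i j j≤i) (Q≡P j (m≤n⇒m≤1+n j≤i)))

  go : Processed P Q (process P Q (suc i) l a (y ∷ ys)) (suc i) l a (y ∷ ys)
  go with (y ∸ 1) ∈ᵇ rowAt P (suc i) in y-1∈
  ... | true = kept (stay (∈ᵇ⇒∈ _ y-1∈) row≡)
  ... | false with a ∧ not (l ∈ᵇ rowAt P (suc i)) in aₗ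
  ...   | true = replaced l (shift (∧-conicalˡ _ _ aₗ))
  ...   | false with firstBetween l y (ejectable (drop (suc i) Q)) in eq
  ...     | just x  = let l<x , x<y , least = firstBetween-just eq in replaced x (eject l<x x<y least)
  ...     | nothing = kept (none (firstBetween-nothing eq) row≡)

trace-length : ∀ {P T m i l a} → Trace P T m i l a →
  ∀ {j} → j < i → length (rowAt T (suc j)) ≡ length (rowAt P (suc j))
trace-length (step {i} _ s tr) {j} j<1+i with m≤n⇒m<n∨m≡n j<1+i
... | inj₁ (s≤s j<i) = trace-length tr j<i
... | inj₂ refl = row s
  where
  row : ∀ {R R′ E l a y a′} → Step R R′ E l a y a′ → length R′ ≡ length R
  row (stay _ eq)              = cong length eq
  row {R} (shift _ eq)         = trans (cong length eq) (length-map _ R)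
  row {R} (eject _ _ _ eq)     = trans (cong length eq) (length-map _ R)
  row (none _ eq)              = cong length eq

-- A second path that starts below the processed rows

-- If v ≤ k replaces m and y > k lies in the new row, then y is one of the old
-- entries above l other than m, hence exceeds m.
replaced-above : ∀ {R l m v y k} → IsMinAbove R l m → l < k → v ≤ k → k < y →
  y ∈ map (sub m v) R → m < y
replaced-above (_ , _ , least) l<k v≤k k<y y∈ with ∈-map-sub⁻ y∈
... | inj₁ refl        = contradiction v≤k (<⇒≱ k<y)
... | inj₂ (y∈R , y≢m) = ≤∧≢⇒< (least y∈R (<-trans l<k k<y)) (y≢m ∘ sym)

-- In `stay`, `m ∸ 1 ≤ l` gives `m ≤ l + 1 ≤ k`. In `none`, no ejectable value lies strictly between
-- `l` and `m`, so `m ≤ k`. In the other two cases the value put in place of `m` is at most `k`, so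
-- `y` is an old entry beyond `m`.
step-above : ∀ {R R′ E l a m a′ k y} → IsMinAbove R l m → Step R R′ E l a m a′ →
  l < k → ejectable E k ≡ true → IsMinAbove R′ k y → m < y
step-above {m = m} min (stay m-1∈ refl) l<k e (y∈ , k<y , _) =
  ≤-<-trans (≤-trans (pred≤⇒≤suc (minAbove-pred min m-1∈)) l<k) k<y
  where
  pred≤⇒≤suc : ∀ {m l} → m ∸ 1 ≤ l → m ≤ suc l
  pred≤⇒≤suc {zero}  _ = z≤n
  pred≤⇒≤suc {suc m} h = s≤s h
step-above min (shift _ refl) l<k e (y∈ , k<y , _) = replaced-above min l<k (<⇒≤ l<k) k<y y∈
step-above min (eject _ _ least refl) l<k e (y∈ , k<y , _) = replaced-above min l<k (least l<k e) k<y y∈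
step-above min (none least refl) l<k e (y∈ , k<y , _) = ≤-<-trans (least l<k e) k<y

trace-above : ∀ {P T m i l a k ks} → Trace P T m i l a → Climb T i k ks →
  ejectable (drop i T) k ≡ true → l < k → m < lastOf k ks
trace-above done [] e l<k = l<k
trace-above {T = T} (step min s tr) (min′ ∷ climb) e l<k =
  trace-above tr climb (climb-ejectable {T} min′ e) (step-above min s l<k e min′)

-- A second path that starts in a processed row

-- Strictness under a set bit is what a later `shift` needs: it puts `l` itself into the row, and
-- the second path is bounded by this entry only if `k < l`.
Below : ℕ → Bool → ℕ → Set
Below l a k = k ≤ l × (a ≡ true → k < l)

-- Each case exhibits an entry of the new row above `k`, which bounds `y`: `m` in `none` and `stay`,
-- sharpened to `m ∸ 1` in `stay` when the bit is set, `l` in `shift`, and `x` in `eject`.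
step-below : ∀ {R R′ E l a m a′ k y} → IsMinAbove R l m → Step R R′ E l a m a′ →
  Below l a k → IsMinAbove R′ k y → Below m a′ y
step-below {m = suc m} min@(m∈ , l<m , _) (stay m-1∈ refl) (k≤l , k<l) (_ , _ , least) =
  least m∈ (≤-<-trans k≤l l<m) ,
  λ a → s≤s (least m-1∈ (<-≤-trans (k<l a) (≤-pred l<m)))
step-below {m = zero} (_ , () , _) (stay _ _) _ _
step-below {l = l} (m∈ , l<m , _) (shift a refl) (_ , k<l) (_ , _ , least) = <⇒≤ y<m , λ _ → y<m
  where y<m = ≤-<-trans (least (∈-map-sub⁺ l m∈) (k<l a)) l<m
step-below (m∈ , _ , _) (eject {x} l<x x<m _ refl) (k≤l , _) (_ , _ , least) = <⇒≤ y<m , λ _ → y<m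
  where y<m = ≤-<-trans (least (∈-map-sub⁺ x m∈) (≤-<-trans k≤l l<x)) x<m
step-below (m∈ , l<m , _) (none _ refl) (k≤l , _) (_ , _ , least) = least m∈ (≤-<-trans k≤l l<m) , λ ()

trace-below : ∀ {P T m i l a k ks} → Trace P T m i l a → Climb T i k ks → Below l a k → lastOf k ks ≤ m
trace-below done [] (k≤l , _) = k≤l
trace-below (step min s tr) (min′ ∷ climb) b = trace-below tr climb (step-below min s b min′)

-- Substitution keeps positions, so the new last entry comes from the old one, `z`, and `z ≤ m`.
-- Either `z = m` and it becomes `v`, or it stays and `z < m`.
last-replaced : ∀ {R m v k} → AllPairs _>_ R → m ∈ R → v < m → IsLast (map (sub m v) R) k → Below m true k
last-replaced {R} {m} {v} R↓ m∈ v<m (n , len , eq) with nth-map (sub m v) R n eq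
... | z , z-last , refl with sub-cases m v z
...   | inj₁ (_ , eq′)   = subst (Below m true) (sym eq′) (<⇒≤ v<m , λ _ → v<m)
...   | inj₂ (z≢m , eq′) = subst (Below m true) (sym eq′) (<⇒≤ z<m , λ _ → z<m)
  where
  z<m : z < m
  z<m = ≤∧≢⇒< (All.lookup (last-least R↓ (n , trans (sym (length-map _ R)) len , z-last)) m∈) z≢m

last-below : ∀ {R R′ E l a m a′ k} → AllPairs _>_ R → IsMinAbove R l m → Step R R′ E l a m a′ →
  IsLast R′ k → Below m a′ k
last-below {m = suc m} R↓ (m∈ , _) (stay m-1∈ refl) last =
  All.lookup (last-least R↓ last) m∈ , λ _ → s≤s (All.lookup (last-least R↓ last) m-1∈)
last-below {m = zero} R↓ (_ , () , _) (stay _ _) last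
last-below R↓ (m∈ , _) (none _ refl) last = All.lookup (last-least R↓ last) m∈ , λ ()
last-below {R} R↓ (m∈ , l<m , _) (shift _ refl) last = last-replaced R↓ m∈ l<m last
last-below R↓ (m∈ , _ , _) (eject _ x<m _ refl) last = last-replaced R↓ m∈ x<m last

-- Steps for rows under the starting row are discarded. In the starting row the invariant holds
-- because the path begins at the least entry, and from there it propagates upwards.
trace-below-last : ∀ {P T m i l a j k ks} → (∀ i → AllPairs _>_ (rowAt P i)) → Trace P T m i l a →
  j < i → IsLast (rowAt T (suc j)) k → Climb T j k ks → lastOf k ks ≤ m
trace-below-last P↓ (step {i} min s tr) j<1+i last climb with m≤n⇒m<n∨m≡n j<1+i
... | inj₁ (s≤s j<i) = trace-below-last P↓ tr j<i last climb
... | inj₂ refl      = trace-below tr climb (last-below (P↓ (suc i)) min s last)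

-- Comparison of the two insertions

Ψ-Climb : ∀ P i c α {Q m} → Ψ P (suc i) (suc c) α ≡ just (Q , m) →
  ∃₂ λ k ks → nth (rowAt P (suc i)) c ≡ just k × Climb P i k ks × lastOf k ks ≡ m ×
    Q ≡ (if α then process P (deleteLastOfRow (suc i) P) i k true ks
              else process P P (suc i) 0 false (k ∷ ks))
Ψ-Climb P i c α eq with nth (rowAt P (suc i)) c
Ψ-Climb P i c α () | nothing
... | just k with upPath P i k in eqᵤ
Ψ-Climb P i c α () | just k | nothing
... | just ks with α
Ψ-Climb P i c α refl | just k | just ks | true  = k , ks , refl , upPath⇒Climb P i k eqᵤ , refl , refl
Ψ-Climb P i c α refl | just k | just ks | false = k , ks , refl , upPath⇒Climb P i k eqᵤ , refl , refl

-- Processed rows have length at least `c` and all lower rows are shorter, so both sides of the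
-- equivalence are decided by whether the second path starts below the `i` processed rows.
compare : ∀ {P T m i l a c j k ks} → (∀ n → AllPairs _>_ (rowAt P n)) → Trace P T m i l a →
  (∀ n → n < i → c ≤ length (rowAt T (suc n))) →
  (∀ n → i ≤ n → Good (rowAt T (suc n)) × length (rowAt T (suc n)) < c) →
  All (l <_) (rowAt T (suc i)) → IsLast (rowAt T (suc j)) k → Climb T j k ks →
  length (rowAt T (suc j)) < c ⇔ m < lastOf k ks
compare {T = T} {i = i} {j = j} P↓ tr ≥c good<c l< last climb with i ≤? j
... | no i≰j = mk⇔ (λ <c → contradiction (≥c j (≰⇒> i≰j)) (<⇒≱ <c))
                   (λ m<m′ → contradiction (trace-below-last P↓ tr (≰⇒> i≰j) last climb) (<⇒≱ m<m′))
... | yes i≤j with climb-to i i≤j climb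
                     (ejectable⁺ T j (nth⇒∈ _ _ (proj₂ (proj₂ last)))
                       (λ k-1∈ → last-pred∉ (proj₁ (good<c j i≤j)) last k-1∈))
...   | _ , _ , climb′ , e , end≡ =
  -- After climbing to the row just below the processed ones, the path value is ejectable there.
  -- Hence it is an entry of that row and exceeds `l`.
  mk⇔ (λ _ → subst (_ <_) end≡ (trace-above tr climb′ e (All.lookup l< (ejectable⁻ T i e))))
      (λ _ → proj₂ (good<c j i≤j))

good-rows : ∀ {P} → DecreasingTableau P → ∀ n → Good (rowAt P n)
good-rows dec n =
  Linked⇒AllPairs (λ x>y y>z → <-trans y>z x>y) (rowAt-All [] rowsDecr n) , rowAt-All [] positive n
  where open DecreasingTableau dec

-- This makes the starting cell for `α = 0` an ordinary path step from the conventional value 0.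
last-minAbove : ∀ {R k} → Good R → IsLast R k → IsMinAbove R 0 k
last-minAbove {R} (R↓ , R⁺) last@(n , _ , eq) =
  nth⇒∈ R n eq , All.lookup R⁺ (nth⇒∈ R n eq) , λ z∈ _ → All.lookup (last-least R↓ last) z∈

module _ {P i c} (dec : DecreasingTableau P) (rem : Removable P (suc i) (suc c)) where
  open DecreasingTableau dec

  private
    P-good = good-rows dec
    P↓ = proj₁ ∘ P-good
    len = proj₁ (proj₂ (proj₂ rem))

    above-≥ : ∀ n → n ≤ i → suc c ≤ length (rowAt P (suc n))
    above-≥ n n≤i = subst (_≤ _) len (rowAt-length-mono shape n≤i)

    below-< : ∀ n → i < n → length (rowAt P (suc n)) < suc c
    below-< n i<n = ≤-<-trans (rowAt-length-mono shape i<n) (proj₂ (proj₂ (proj₂ rem)))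

  module _ {k ks} (k-last : nth (rowAt P (suc i)) c ≡ just k) (climb : Climb P i k ks) where

    private
      last : IsLast (rowAt P (suc i)) k
      last = c , len , k-last

    -- The row of the removable cell counts as processed, since it keeps its length `suc c`. The
    -- value arriving from below is 0, so positivity gives the bound on the next row.
    compare-keep : ∀ {T j k′ ks′} → T ≡ process P P (suc i) 0 false (k ∷ ks) →
      IsLast (rowAt T (suc j)) k′ → Climb T j k′ ks′ →
      length (rowAt T (suc j)) < suc c ⇔ lastOf k ks < lastOf k′ ks′
    compare-keep {T} refl = compare P↓ trace
      (λ n n≤i → ≤-trans (above-≥ n (≤-pred n≤i)) (≤-reflexive (sym (trace-length trace n≤i))))
      (λ n i<n → subst (λ R → Good R × length R < suc c) (sym (row≡ i<n)) (P-good (suc n) , below-< n i<n))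
      (subst (All (0 <_)) (sym (row≡ ≤-refl)) (proj₂ (P-good (suc (suc i)))))
      where
      processed = process-spec P P {a = false}
        (last-minAbove (P-good (suc i)) last ∷ climb) (λ _ _ → refl)
      trace = proj₁ processed
      row≡ : ∀ {n} → suc i ≤ n → rowAt T (suc n) ≡ rowAt P (suc n)
      row≡ = rowAt-cong-drop {T} {P} (proj₂ processed)

    -- The row of the removable cell has dropped to length `c`, so it now counts among the shorter,
    -- unprocessed rows. The value arriving from it is the deleted `k`, smaller than every entry
    -- left.
    compare-delete : ∀ {T j k′ ks′} → T ≡ process P (deleteLastOfRow (suc i) P) i k true ks →
      IsLast (rowAt T (suc j)) k′ → Climb T j k′ ks′ →
      length (rowAt T (suc j)) < suc c ⇔ lastOf k ks < lastOf k′ ks′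
    compare-delete {T} refl = compare P↓ trace
      (λ n n<i → ≤-trans (above-≥ n (<⇒≤ n<i)) (≤-reflexive (sym (trace-length trace n<i))))
      (λ n i≤n → subst (λ R → Good R × length R < suc c) (sym (row≡ i≤n)) (good-short n i≤n))
      (subst (All (k <_)) (sym (row≡ ≤-refl)) k<)
      where
      D = deleteLastOfRow (suc i) P
      processed = process-spec P D {a = true} climb (rowAt-deleteLast-< P i)
      trace = proj₁ processed
      row≡ : ∀ {n} → i ≤ n → rowAt T (suc n) ≡ rowAt D (suc n)
      row≡ = rowAt-cong-drop {T} {D} (proj₂ processed)
      shortened : length (dropLast (rowAt P (suc i))) ≡ c
      shortened = length-dropLast (rowAt P (suc i)) len

      good-short : ∀ n → i ≤ n → Good (rowAt D (suc n)) × length (rowAt D (suc n)) < suc c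
      good-short n i≤n with rowAt-deleteLast-≥ P i n i≤n
      ... | inj₁ eq rewrite eq =
        dropLast-Good (rowAt P (suc i)) (P-good (suc i)) , s≤s (≤-reflexive shortened)
      ... | inj₂ (q , i<q , eq , _) rewrite eq = P-good (suc q) , below-< q i<q

      k< : All (k <_) (rowAt D (suc i))
      k< with rowAt-deleteLast-≥ P i i ≤-refl
      ... | inj₁ eq rewrite eq = last<dropLast (P↓ (suc i)) last
      -- The row consisted of one cell, so `c = 0`. The row that takes its place has length less
      -- than 1, hence no entries to bound.
      ... | inj₂ (q , i<q , eq , eq[]) rewrite eq =
        empty (rowAt P (suc q)) (subst (λ n → length (rowAt P (suc q)) < suc n)
          (trans (sym shortened) (cong length (eq[] refl))) (below-< q i<q))
        where
        empty : ∀ R → length R < 1 → All (k <_) R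
        empty []      _        = []
        empty (_ ∷ _) (s≤s ())

theorem5p8 : (P : Tableau) (r₁ c₁ : ℕ) (α : Bool) (P′ : Tableau) (m : ℕ) →
    DecreasingTableau P → Removable P r₁ c₁ → Ψ P r₁ c₁ α ≡ just (P′ , m) →
    (r₂ c₂ : ℕ) (α′ : Bool) (P″ : Tableau) (m′ : ℕ) →
    Removable P′ r₂ c₂ → Ψ P′ r₂ c₂ α′ ≡ just (P″ , m′) →
    (c₂ < c₁ ⇔ m < m′)
theorem5p8 P zero _ _ _ _ dec (() , _)
theorem5p8 P (suc i) zero _ _ _ dec (_ , () , _)
theorem5p8 P (suc i) (suc c) α P′ m dec rem eq zero _ _ _ _ (() , _)
theorem5p8 P (suc i) (suc c) α P′ m dec rem eq (suc j) zero _ _ _ (_ , () , _)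
theorem5p8 P (suc i) (suc c) α P′ m dec rem eq (suc j) (suc c′) α′ P″ m′ (_ , _ , len′ , _) eq′
  with Ψ-Climb P i c α eq | Ψ-Climb P′ j c′ α′ eq′
... | k , ks , k-last , climb , refl , P′≡ | k′ , ks′ , k′-last , climb′ , refl , _ =
  -- By removability `suc c′` is the length of row `suc j` of `P′`, so the comparison of columns
  -- becomes one of a row length with `suc c`.
  subst (λ n → n < suc c ⇔ lastOf k ks < lastOf k′ ks′) len′ (by-bit α P′≡)
  where
  by-bit : ∀ α →
    P′ ≡ (if α then process P (deleteLastOfRow (suc i) P) i k true ks
               else process P P (suc i) 0 false (k ∷ ks)) →
    length (rowAt P′ (suc j)) < suc c ⇔ lastOf k ks < lastOf k′ ks′
  by-bit true  P′≡ = compare-delete dec rem k-last climb P′≡ (c′ , len′ , k′-last) climb′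
  by-bit false P′≡ = compare-keep dec rem k-last climb P′≡ (c′ , len′ , k′-last) climb′
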